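{- Let $n$ and $k$ be integers with $n\ge 1$. Then $$\mathfrak C_{2n}^{(k)}=\sum_{m=1}^{n}\frac{(-4)^{n-m}}{(2m+1)^k}\left[\!\!\left[n\atop m\right]\!\!\right],$$ where for $m=1,2,\dots,n$ $$\left[\!\!\left[n\atop m\right]\!\!\right]=\left[n\atop m\right]^2-2\left[n\atop m-1\right]\left[n\atop m+1\right]+2\left[n\atop m-2\right]\left[n\atop m+2\right]-\cdots+2(-1)^{m-1}\left[n\atop 1\right]\left[n\atop 2m-1\right],$$ that is, $\left[\!\!\left[n\atop m\right]\!\!\right]=\left[n\atop m\right]^2+2\sum_{j=1}^{m-1}(-1)^j\left[n\atop m-j\right]\left[n\atop m+j\right]$, and $\left[\!\!\left[n\atop 0\right]\!\!\right]=0$.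
   Context: For an integer $k$, the polylogarithm factorial function with level $2$ is ${\rm Lif}_{2,k}(z)=\sum_{m=0}^\infty\frac{z^{2m}}{(2m)!(2m+1)^k}$, and the poly-Cauchy numbers with level $2$, $\mathfrak C_n^{(k)}$, are defined by the generating function ${\rm Lif}_{2,k}({\rm arcsinh}\,t)=\sum_{n=0}^\infty\mathfrak C_n^{(k)}\frac{t^n}{n!}$, where ${\rm arcsinh}$ is the inverse hyperbolic sine. Here $\left[n\atop m\right]$ denotes the unsigned Stirling numbers of the first kind, defined by $x(x+1)\cdots(x+n-1)=\sum_{m=0}^n\left[n\atop m\right]x^m$, with $\left[n\atop m\right]=0$ for $m>n$. -}

module Defs where

open import Data.Nat.Base as ℕ using (ℕ; zero; suc; _∸_; _!)
import Data.Nat.Properties as ℕ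
open import Data.Integer.Base as ℤ using (ℤ; -[1+_])
open import Data.Rational.Base using (ℚ; 0ℚ; 1ℚ; _/_; _+_; _-_; _*_; -_)
import Data.Rational.Properties as ℚ
open import Data.Fin.Base using (Fin; toℕ)
open import Data.Fin.Properties using (toℕ<n)
open import Data.Sum.Base using (inj₁; inj₂)
open import Function.Base using (_∘_)
open import Relation.Binary.PropositionalEquality
open import Algebra.Bundles using (CommutativeRing)
open import Algebra.Properties.Semiring.Exp (CommutativeRing.semiring ℚ.+-*-commutativeRing) public using (_^_)
open import Algebra.Properties.Semiring.Sum (CommutativeRing.semiring ℚ.+-*-commutativeRing) public using (sum; sum-cong-≗; sum-replicate-zero; ∑-distrib-+; sum-syntax)

infixr 8 _^ℤ_

_^ℤ_ : (a : ℕ) .{{_ : ℕ.NonZero a}} → ℤ → ℚ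
a ^ℤ (ℤ.+ k)  = ℤ.+ (a ℕ.^ k) / 1
a ^ℤ -[1+ k ] = _/_ (ℤ.+ 1) (a ℕ.^ suc k) {{ℕ.m^n≢0 a (suc k)}}

1/_! : ℕ → ℚ
1/ n ! = _/_ (ℤ.+ 1) (n !) {{n ℕ.!≢0}}

-- A formal power series over ℚ, as its coefficient sequence.

Series : Set
Series = ℕ → ℚ

infixl 6 _⊕_ _⊖_
infixl 7 _⊛_
infixr 8 _^ˢ_

const : ℚ → Series
const c zero    = c
const c (suc _) = 0ℚ

X : Series
X 1 = 1ℚ
X _ = 0ℚ

_⊕_ _⊖_ _⊛_ : Series → Series → Series
(f ⊕ g) n = f n + g n
(f ⊖ g) n = f n - g n
(f ⊛ g) n = ∑[ i < suc n ] (f (toℕ i) * g (n ∸ toℕ i))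

_^ˢ_ : Series → ℕ → Series
f ^ˢ zero  = const 1ℚ
f ^ˢ suc i = f ⊛ f ^ˢ i

-- The composite f(g(t)), meaningful when g has zero constant term:
-- gⁱ then starts in degree i, so the sum may stop at i = n.
_⟨_⟩ : Series → Series → Series
(f ⟨ g ⟩) n = ∑[ i < suc n ] (f (toℕ i) * (g ^ˢ toℕ i) n)

-- evens c = Σ c(m) t²ᵐ  and  odds c = Σ c(m) t²ᵐ⁺¹.
evens odds : (ℕ → ℚ) → Series
evens c 0             = c 0
evens c 1             = 0ℚ
evens c (suc (suc i)) = evens (c ∘ suc) i
odds c zero    = 0ℚ
odds c (suc i) = evens c i

-- The compositional inverse of f = t + O(t²), as the fixed point of
-- g ↦ t - (f - t)(g). Each iteration settles one further coefficient.
approxInverse : Series → ℕ → Series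
approxInverse f zero    = const 0ℚ
approxInverse f (suc n) = X ⊖ (f ⊖ X) ⟨ approxInverse f n ⟩

inverse : Series → Series
inverse f n = approxInverse f n n

sinh arcsinh : Series
sinh    = odds λ m → 1/ suc (2 ℕ.* m) !
arcsinh = inverse sinh

Lif₂ : ℤ → Series
Lif₂ k = evens λ m → 1/ (2 ℕ.* m) ! * suc (2 ℕ.* m) ^ℤ (ℤ.- k)

-- 𝔠 k n is the poly-Cauchy number with level 2 of index k.
𝔠 : ℤ → ℕ → ℚ
𝔠 k n = ℤ.+ (n !) / 1 * (Lif₂ k ⟨ arcsinh ⟩) n

-- x (x + 1) ⋯ (x + n - 1)
rising : ℕ → Series
rising zero    = const 1ℚ
rising (suc n) = rising n ⊛ (X ⊕ const (ℤ.+ n / 1))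

-- Unsigned Stirling numbers of the first kind, as rationals.
[_,_] : ℕ → ℕ → ℚ
[ n , m ] = rising n m

⟦_,_⟧ : ℕ → ℕ → ℚ
⟦ n , zero ⟧ = 0ℚ
⟦ n , m@(suc m-1) ⟧ = [ n , m ] ^ 2 + (ℤ.+ 2 / 1) * ∑[ i < m-1 ]
  (let j = suc (toℕ i) in (- 1ℚ) ^ j * [ n , m ∸ j ] * [ n , m ℕ.+ j ])

infix 4 _≈[_]_
_≈[_]_ : Series → ℕ → Series → Set
f ≈[ n ] g = ∀ i → i ℕ.≤ n → f i ≡ g i

⊛-cong : ∀ {f f′ g g′ n} → f ≈[ n ] f′ → g ≈[ n ] g′ → f ⊛ g ≈[ n ] f′ ⊛ g′
⊛-cong p q k k≤n = sum-cong-≗ {suc k} λ i → cong₂ _*_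
  (p _ (ℕ.≤-trans (ℕ.≤-pred (toℕ<n i)) k≤n))
  (q _ (ℕ.≤-trans (ℕ.m∸n≤m k (toℕ i)) k≤n))

^ˢ-cong : ∀ {f g n} → f ≈[ n ] g → ∀ i → f ^ˢ i ≈[ n ] g ^ˢ i
^ˢ-cong p zero    k _ = refl
^ˢ-cong p (suc i)     = ⊛-cong p (^ˢ-cong p i)

⊛-zero : ∀ f g → f 0 ≡ 0ℚ → (f ⊛ g) 0 ≡ 0ℚ
⊛-zero f g p = trans (ℚ.+-identityʳ _) (trans (cong (_* g 0) p) (ℚ.*-zeroˡ (g 0)))

-- Without constant terms, a product is determined one degree further.
⊛-cong⁺ : ∀ {f f′ g g′ n} → f 0 ≡ 0ℚ → f′ 0 ≡ 0ℚ → g 0 ≡ 0ℚ → g′ 0 ≡ 0ℚ →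
          f ≈[ n ] f′ → g ≈[ n ] g′ → f ⊛ g ≈[ suc n ] f′ ⊛ g′
⊛-cong⁺ {f} {f′} {g} {g′} {n} f₀ f′₀ g₀ g′₀ p q k k≤ =
  sum-cong-≗ {suc k} λ i → term (toℕ i) (ℕ.≤-pred (toℕ<n i))
  where
  vanish : ∀ a b {x y} → x ≡ 0ℚ → y ≡ 0ℚ → a * x ≡ b * y
  vanish a b refl refl = trans (ℚ.*-zeroʳ a) (sym (ℚ.*-zeroʳ b))

  term : ∀ i → i ℕ.≤ k → f i * g (k ∸ i) ≡ f′ i * g′ (k ∸ i)
  term zero _ = trans (ℚ.*-comm (f 0) _) (trans (vanish (g k) (g′ k) f₀ f′₀) (ℚ.*-comm _ (f′ 0)))
  term (suc i) i<k with ℕ.m≤n⇒m<n∨m≡n i<k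
  ... | inj₁ lt = cong₂ _*_
    (p (suc i) (ℕ.≤-pred (ℕ.≤-trans lt k≤)))
    (q (k ∸ suc i) (ℕ.≤-trans (ℕ.∸-monoˡ-≤ (suc i) k≤) (ℕ.m∸n≤m n i)))
  ... | inj₂ refl rewrite ℕ.n∸n≡0 i = vanish (f k) (f′ k) g₀ g′₀

⟨⟩-cong⁺ : ∀ {f g g′ n} → f 0 ≡ 0ℚ → f 1 ≡ 0ℚ → g 0 ≡ 0ℚ → g′ 0 ≡ 0ℚ →
           g ≈[ n ] g′ → f ⟨ g ⟩ ≈[ suc n ] f ⟨ g′ ⟩
⟨⟩-cong⁺ {f} {g} {g′} f₀ f₁ g₀ g′₀ p k k≤ = sum-cong-≗ {suc k} λ i → term (toℕ i)
  where
  term : ∀ i → f i * (g ^ˢ i) k ≡ f i * (g′ ^ˢ i) k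
  term 0 = refl
  term 1 rewrite f₁ = trans (ℚ.*-zeroˡ ((g ^ˢ 1) k)) (sym (ℚ.*-zeroˡ ((g′ ^ˢ 1) k)))
  term (suc (suc i)) = cong (f (2 ℕ.+ i) *_)
    (⊛-cong⁺ g₀ g′₀ (⊛-zero g (g ^ˢ i) g₀) (⊛-zero g′ (g′ ^ˢ i) g′₀)
      p (^ˢ-cong p (suc i)) k k≤)

⟨⟩-distrib-⊕ : ∀ f g h n → ((f ⊕ g) ⟨ h ⟩) n ≡ (f ⟨ h ⟩) n + (g ⟨ h ⟩) n
⟨⟩-distrib-⊕ f g h n = trans
  (sum-cong-≗ {suc n} λ i → ℚ.*-distribʳ-+ ((h ^ˢ toℕ i) n) (f (toℕ i)) (g (toℕ i)))
  (∑-distrib-+ {suc n} (λ i → f (toℕ i) * (h ^ˢ toℕ i) n) (λ i → g (toℕ i) * (h ^ˢ toℕ i) n))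

sum-zero : ∀ n {f : Fin n → ℚ} → (∀ i → f i ≡ 0ℚ) → sum f ≡ 0ℚ
sum-zero n p = trans (sum-cong-≗ p) (sum-replicate-zero n)

⊛-identityʳ : ∀ f n → (f ⊛ const 1ℚ) n ≡ f n
⊛-identityʳ f zero    = trans (ℚ.+-identityʳ _) (ℚ.*-identityʳ (f 0))
⊛-identityʳ f (suc n) = trans
  (cong₂ _+_ (ℚ.*-zeroʳ (f 0)) (⊛-identityʳ (f ∘ suc) n))
  (ℚ.+-identityˡ (f (suc n)))

X⟨⟩ : ∀ g → g 0 ≡ 0ℚ → ∀ n → (X ⟨ g ⟩) n ≡ g n
X⟨⟩ g g₀ zero    = sym g₀
X⟨⟩ g g₀ (suc n) = begin
  0ℚ + (1ℚ * (g ⊛ const 1ℚ) (suc n) + rest)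
    ≡⟨ ℚ.+-identityˡ _ ⟩
  1ℚ * (g ⊛ const 1ℚ) (suc n) + rest
    ≡⟨ cong₂ _+_ (ℚ.*-identityˡ ((g ⊛ const 1ℚ) (suc n))) (sum-zero n λ i → ℚ.*-zeroˡ ((g ^ˢ (2 ℕ.+ toℕ i)) (suc n))) ⟩
  (g ⊛ const 1ℚ) (suc n) + 0ℚ
    ≡⟨ ℚ.+-identityʳ _ ⟩
  (g ⊛ const 1ℚ) (suc n)
    ≡⟨ ⊛-identityʳ g (suc n) ⟩
  g (suc n) ∎
  where
  open ≡-Reasoning
  rest = ∑[ i < n ] (0ℚ * (g ^ˢ (2 ℕ.+ toℕ i)) (suc n))

module _ (f : Series) (f₀ : f 0 ≡ 0ℚ) (f₁ : f 1 ≡ 1ℚ) where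

  private
    h : Series
    h = f ⊖ X

    h₀ : h 0 ≡ 0ℚ
    h₀ rewrite f₀ = refl

    h₁ : h 1 ≡ 0ℚ
    h₁ rewrite f₁ = refl

    approx₀ : ∀ n → approxInverse f n 0 ≡ 0ℚ
    approx₀ zero = refl
    approx₀ (suc n) rewrite f₀ = refl

    approx-step : ∀ n → approxInverse f n ≈[ n ] approxInverse f (suc n)
    approx-step zero    zero    _ = sym (approx₀ 1)
    approx-step (suc n) i     i≤n = cong (λ x → X i - x)
      (⟨⟩-cong⁺ {h} h₀ h₁ (approx₀ n) (approx₀ (suc n)) (approx-step n) i i≤n)

    approx-stable : ∀ n → inverse f ≈[ n ] approxInverse f n
    approx-stable zero    zero _ = refl
    approx-stable (suc n) i  i≤ with ℕ.m≤n⇒m<n∨m≡n i≤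
    ... | inj₁ i<  = trans (approx-stable n i (ℕ.≤-pred i<)) (approx-step n i (ℕ.≤-pred i<))
    ... | inj₂ refl = refl

  inverse-zero : inverse f 0 ≡ 0ℚ
  inverse-zero = refl

  inverse-correct : ∀ n → (f ⟨ inverse f ⟩) n ≡ X n
  inverse-correct n = begin
    (f ⟨ g ⟩) n                   ≡⟨ sum-cong-≗ {suc n} (λ i → cong (_* (g ^ˢ toℕ i) n) (split (toℕ i))) ⟩
    ((h ⊕ X) ⟨ g ⟩) n             ≡⟨ ⟨⟩-distrib-⊕ h X g n ⟩
    (h ⟨ g ⟩) n + (X ⟨ g ⟩) n     ≡⟨ cong ((h ⟨ g ⟩) n +_) (X⟨⟩ g refl n) ⟩
    (h ⟨ g ⟩) n + g n             ≡⟨ cong ((h ⟨ g ⟩) n +_) fixed ⟩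
    (h ⟨ g ⟩) n + (X n - (h ⟨ g ⟩) n) ≡⟨ ℚ.+-comm ((h ⟨ g ⟩) n) _ ⟩
    X n - (h ⟨ g ⟩) n + (h ⟨ g ⟩) n   ≡⟨ cancel (X n) ((h ⟨ g ⟩) n) ⟩
    X n ∎
    where
    open ≡-Reasoning
    g = inverse f

    cancel : ∀ x y → x - y + y ≡ x
    cancel x y = trans (ℚ.+-assoc x (- y) y)
      (trans (cong (x +_) (ℚ.+-inverseˡ y)) (ℚ.+-identityʳ x))

    split : ∀ i → f i ≡ (h ⊕ X) i
    split i = sym (cancel (f i) (X i))

    fixed : g n ≡ X n - (h ⟨ g ⟩) n
    fixed = trans (approx-step n n ℕ.≤-refl) (cong (λ x → X n - x)
      (sym (⟨⟩-cong⁺ {h} h₀ h₁ refl (approx₀ n) (approx-stable n) n (ℕ.n≤1+n n))))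

sinh-arcsinh : ∀ n → (sinh ⟨ arcsinh ⟩) n ≡ X n
sinh-arcsinh = inverse-correct sinh refl refl

{-# OPTIONS --safe #-}

-- Write θ = t d/dt, A = arcsinh and C = cosh A. Differentiating sinh A = t
-- gives C θA = t and then C² = 1 + t², so that (1 + t²) θ²A = θA and
-- (1 + t²) θ²(Aᵖ) = p (p - 1) t² Aᵖ⁻² + θ(Aᵖ): a three-term recurrence for the
-- coefficients of the powers of A. On the other side, multiplying
-- x (x + 1) ⋯ (x + n - 1) by its reflection at x ↦ -x gives ∏_{i<n} (i² - x²),
-- whose coefficient at x²ᵐ is (-1)ᵐ ⟦ n , m ⟧ by symmetry of the convolution.
-- Passing from n to n + 1 multiplies by n² - x², which is the same recurrence
-- up to powers of -4.

module Submission where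

open import Defs
open import Data.Nat.Base as ℕ using (ℕ; zero; suc; _∸_; _!; z≤n; s≤s)
import Data.Nat.Properties as ℕ
open import Data.Integer.Base as ℤ using (ℤ; -[1+_])
import Data.Integer.Properties as ℤ
open import Data.Rational.Base using (ℚ; mkℚ; 0ℚ; 1ℚ; _*_; _/_; _+_; _-_; -_; toℚᵘ)
import Data.Rational.Properties as ℚ
import Data.Rational.Unnormalised.Base as ℚᵘ
import Data.Rational.Unnormalised.Properties as ℚᵘ
import Data.Nat.Coprimality as Coprimality
open import Data.Rational.Solver using (module +-*-Solver)
open import Data.Fin.Base using (toℕ)
open import Data.Fin.Properties using (toℕ<n)
open import Data.Sum.Base using (inj₁; inj₂)
open import Function.Base using (_∘_)
open import Relation.Binary.PropositionalEquality
  using (_≡_; _≗_; refl; sym; trans; cong; cong₂; subst; subst₂; module ≡-Reasoning)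
open import Algebra.Bundles using (CommutativeSemiring; CommutativeRing)
import Relation.Binary.Reasoning.Setoid
import Algebra.Solver.Ring.NaturalCoefficients.Default
import Algebra.Construct.Pointwise as Pointwise
open import Algebra.Properties.Group ℚ.+-0-group using (∙-cancelˡ)
import Algebra.Structures.Biased as Biased
open import Algebra.Properties.Semiring.Exp (CommutativeRing.semiring ℚ.+-*-commutativeRing) using (^-homo-*)
open import Algebra.Properties.Semiring.Sum (CommutativeRing.semiring ℚ.+-*-commutativeRing)
  using (*-distribˡ-sum)

open +-*-Solver using (solve; _:=_; _:+_; _:*_; _:-_; con)

-- Naturals as rationals

ι : ℕ → ℚ
ι n = ℤ.+ n / 1

-- `_/_` normalises by a gcd, which is stuck on a variable `n`. Rewriting with this normal form lets
-- rational addition and multiplication compute.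
ι≡mkℚ : ∀ n → ι n ≡ mkℚ (ℤ.+ n) 0 (Coprimality.sym (Coprimality.1-coprimeTo n))
ι≡mkℚ n = ℚ.normalize-coprime (Coprimality.sym (Coprimality.1-coprimeTo n))

ι-+ : ∀ m n → ι (m ℕ.+ n) ≡ ι m + ι n
ι-+ m n rewrite ι≡mkℚ m | ι≡mkℚ n =
  cong (_/ 1) (sym (cong₂ ℤ._+_ (ℤ.*-identityʳ (ℤ.+ m)) (ℤ.*-identityʳ (ℤ.+ n))))

ι-* : ∀ m n → ι (m ℕ.* n) ≡ ι m * ι n
ι-* m n rewrite ι≡mkℚ m | ι≡mkℚ n = cong (_/ 1) (ℤ.pos-* m n)

-- Checked on unnormalised rationals, where equality is cross-multiplication and no gcd intervenes.
1/n*n : ∀ n .{{_ : ℕ.NonZero n}} → (ℤ.+ 1 / n) * ι n ≡ 1ℚ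
1/n*n n@(suc n-1) = ℚ.toℚᵘ-injective (begin
  toℚᵘ ((ℤ.+ 1 / n) * ι n)               ≈⟨ ℚ.toℚᵘ-homo-* (ℤ.+ 1 / n) (ι n) ⟩
  toℚᵘ (ℤ.+ 1 / n) ℚᵘ.* toℚᵘ (ι n)       ≈⟨ ℚᵘ.*-cong (ℚ.toℚᵘ-fromℚᵘ (ℚᵘ.mkℚᵘ (ℤ.+ 1) n-1)) (ℚ.toℚᵘ-fromℚᵘ (ℚᵘ.mkℚᵘ (ℤ.+ n) 0)) ⟩
  ℚᵘ.mkℚᵘ (ℤ.+ 1) n-1 ℚᵘ.* ℚᵘ.mkℚᵘ (ℤ.+ n) 0
    ≈⟨ ℚᵘ.*≡* (trans (ℤ.*-assoc (ℤ.+ 1) (ℤ.+ n) (ℤ.+ 1)) (cong (ℤ.+ 1 ℤ.*_) (sym (ℤ.pos-* n 1)))) ⟩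
  ℚᵘ.1ℚᵘ ∎)
  where open ℚᵘ.≃-Reasoning

1/!*! : ∀ n → 1/ n ! * ι (n !) ≡ 1ℚ
1/!*! n = 1/n*n (n !) {{n ℕ.!≢0}}

1/!-suc : ∀ n → 1/ suc n ! * ι (suc n) ≡ 1/ n !
1/!-suc n = begin
  a * s                        ≡⟨ solve 2 (λ a s → a :* s := a :* s :* con 1ℚ) refl a s ⟩
  a * s * 1ℚ                   ≡⟨ cong (a * s *_) (1/!*! n) ⟨
  a * s * (b * f)              ≡⟨ solve 4 (λ a s b f → a :* s :* (b :* f) := b :* (a :* (s :* f))) refl a s b f ⟩
  b * (a * (s * f))            ≡⟨ cong (λ x → b * (a * x)) (ι-* (suc n) (n !)) ⟨
  b * (a * ι (suc n !))        ≡⟨ cong (b *_) (1/!*! (suc n)) ⟩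
  b * 1ℚ                       ≡⟨ ℚ.*-identityʳ b ⟩
  b ∎
  where
  open ≡-Reasoning
  a = 1/ suc n !
  b = 1/ n !
  s = ι (suc n)
  f = ι (n !)

-- The semiring of power series

0ˢ 1ˢ : Series
0ˢ _ = 0ℚ
1ˢ   = const 1ℚ

infixr 7 _·_
_·_ : ℚ → Series → Series
(c · f) n = c * f n

⊕-cong : ∀ {f f′ g g′} → f ≗ f′ → g ≗ g′ → f ⊕ g ≗ f′ ⊕ g′
⊕-cong p q n = cong₂ _+_ (p n) (q n)

⊛-congᶠ : ∀ {f f′ g g′} → f ≗ f′ → g ≗ g′ → f ⊛ g ≗ f′ ⊛ g′
⊛-congᶠ p q n = ⊛-cong (λ i _ → p i) (λ i _ → q i) n ℕ.≤-refl

⊛-zeroˡ : ∀ f → 0ˢ ⊛ f ≗ 0ˢ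
⊛-zeroˡ f n = sum-zero (suc n) λ i → ℚ.*-zeroˡ (f (n ∸ toℕ i))

⊛-zeroʳ : ∀ f → f ⊛ 0ˢ ≗ 0ˢ
⊛-zeroʳ f n = sum-zero (suc n) λ i → ℚ.*-zeroʳ (f (toℕ i))

⊛-distribʳ : ∀ h f g → (f ⊕ g) ⊛ h ≗ f ⊛ h ⊕ g ⊛ h
⊛-distribʳ h f g n = trans
  (sum-cong-≗ {suc n} λ i → ℚ.*-distribʳ-+ (h (n ∸ toℕ i)) (f (toℕ i)) (g (toℕ i)))
  (∑-distrib-+ {suc n} (λ i → f (toℕ i) * h (n ∸ toℕ i)) (λ i → g (toℕ i) * h (n ∸ toℕ i)))

·-⊛ : ∀ c f g → (c · f) ⊛ g ≗ c · (f ⊛ g)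
·-⊛ c f g n = trans
  (sum-cong-≗ {suc n} λ i → ℚ.*-assoc c (f (toℕ i)) (g (n ∸ toℕ i)))
  (sym (*-distribˡ-sum {suc n} c λ i → f (toℕ i) * g (n ∸ toℕ i)))

-- By definition `⊛` peels the constant term off its left factor; this is the mirror image, from
-- which commutativity follows by induction on the degree.
⊛-sucʳ : ∀ f g n → (f ⊛ g) (suc n) ≡ f (suc n) * g 0 + (f ⊛ (g ∘ suc)) n
⊛-sucʳ f g zero = solve 2 (λ a b → a :+ (b :+ con 0ℚ) := b :+ (a :+ con 0ℚ)) refl (f 0 * g 1) (f 1 * g 0)
⊛-sucʳ f g (suc n) = trans (cong (f 0 * g (2 ℕ.+ n) +_) (⊛-sucʳ (f ∘ suc) g n))
  (solve 3 (λ a b c → a :+ (b :+ c) := b :+ (a :+ c)) refl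
    (f 0 * g (2 ℕ.+ n)) (f (2 ℕ.+ n) * g 0) (((f ∘ suc) ⊛ (g ∘ suc)) n))

⊛-comm : ∀ f g → f ⊛ g ≗ g ⊛ f
⊛-comm f g zero    = cong (_+ 0ℚ) (ℚ.*-comm (f 0) (g 0))
⊛-comm f g (suc n) = trans
  (cong₂ _+_ (ℚ.*-comm (f 0) (g (suc n))) (⊛-comm (f ∘ suc) g n))
  (sym (⊛-sucʳ g f n))

-- Induction on the degree. The shift of `f ⊛ g` is `(f 0 · (g ∘ suc)) ⊕ ((f ∘ suc) ⊛ g)` by
-- computation, so the hypothesis is applied to `f ∘ suc`.
⊛-assoc : ∀ f g h → (f ⊛ g) ⊛ h ≗ f ⊛ (g ⊛ h)
⊛-assoc f g h zero = solve 3
  (λ a b c → (a :* b :+ con 0ℚ) :* c :+ con 0ℚ := a :* (b :* c :+ con 0ℚ) :+ con 0ℚ) refl (f 0) (g 0) (h 0)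
⊛-assoc f g h (suc n) = begin
  (f 0 * g 0 + 0ℚ) * h (suc n) + (((f 0 · (g ∘ suc)) ⊕ ((f ∘ suc) ⊛ g)) ⊛ h) n
    ≡⟨ cong (k +_) (⊛-distribʳ h (f 0 · (g ∘ suc)) ((f ∘ suc) ⊛ g) n) ⟩
  k + (((f 0 · (g ∘ suc)) ⊛ h) n + (((f ∘ suc) ⊛ g) ⊛ h) n)
    ≡⟨ cong₂ (λ x y → k + (x + y)) (·-⊛ (f 0) (g ∘ suc) h n) (⊛-assoc (f ∘ suc) g h n) ⟩
  k + (f 0 * ((g ∘ suc) ⊛ h) n + ((f ∘ suc) ⊛ (g ⊛ h)) n)
    ≡⟨ solve 5 (λ a b c d e → (a :* b :+ con 0ℚ) :* c :+ (a :* d :+ e) := a :* (b :* c :+ d) :+ e) refl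
         (f 0) (g 0) (h (suc n)) (((g ∘ suc) ⊛ h) n) (((f ∘ suc) ⊛ (g ⊛ h)) n) ⟩
  f 0 * (g 0 * h (suc n) + ((g ∘ suc) ⊛ h) n) + ((f ∘ suc) ⊛ (g ⊛ h)) n ∎
  where
  open ≡-Reasoning
  k = (f 0 * g 0 + 0ℚ) * h (suc n)

-- Feeds the solver `Ser`. The bundle has no subtraction, which is why `W⊛θT` ends by cancelling a
-- summand.
seriesSemiring : CommutativeSemiring _ _
seriesSemiring = record
  { Carrier = Series ; _≈_ = _≗_ ; _+_ = _⊕_ ; _*_ = _⊛_ ; 0# = 0ˢ ; 1# = 1ˢ
  ; isCommutativeSemiring = Biased.isCommutativeSemiringˡ record
    { +-isCommutativeMonoid = Pointwise.isCommutativeMonoid ℕ ℚ.+-0-isCommutativeMonoid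
    ; *-isCommutativeMonoid = Biased.isCommutativeMonoidʳ record
      { isSemigroup = record
        { isMagma = record
          { isEquivalence = Pointwise.isEquivalence ℕ (CommutativeRing.isEquivalence ℚ.+-*-commutativeRing)
          ; ∙-cong = ⊛-congᶠ }
        ; assoc = ⊛-assoc }
      ; identityʳ = ⊛-identityʳ
      ; comm = ⊛-comm }
    ; distribʳ = ⊛-distribʳ
    ; zeroˡ = ⊛-zeroˡ } }

open CommutativeSemiring seriesSemiring using (setoid; *-identityˡ)
  renaming (refl to ≗-refl; sym to ≗-sym; trans to ≗-trans)
module ≗-Reasoning = Relation.Binary.Reasoning.Setoid setoid
module Ser = Algebra.Solver.Ring.NaturalCoefficients.Default seriesSemiring

-- The Euler operator t d/dt

θ : Series → Series
θ f n = ι n * f n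

θ-cong : ∀ {f g} → f ≗ g → θ f ≗ θ g
θ-cong p n = cong (ι n *_) (p n)

θ-⊕ : ∀ f g → θ (f ⊕ g) ≗ θ f ⊕ θ g
θ-⊕ f g n = ℚ.*-distribˡ-+ (ι n) (f n) (g n)

θ-1ˢ : θ 1ˢ ≗ 0ˢ
θ-1ˢ zero    = refl
θ-1ˢ (suc n) = ℚ.*-zeroʳ (ι (suc n))

θ-X : θ X ≗ X
θ-X 0             = refl
θ-X 1             = refl
θ-X (suc (suc n)) = ℚ.*-zeroʳ (ι (2 ℕ.+ n))

-- Holds term by term: the two factors contribute degrees `i` and `n ∸ i`, which add up to `n`.
θ-⊛ : ∀ f g → θ (f ⊛ g) ≗ θ f ⊛ g ⊕ f ⊛ θ g
θ-⊛ f g n = begin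
  ι n * (f ⊛ g) n
    ≡⟨ *-distribˡ-sum {suc n} (ι n) (λ i → f (toℕ i) * g (n ∸ toℕ i)) ⟩
  ∑[ i < suc n ] (ι n * (f (toℕ i) * g (n ∸ toℕ i)))
    ≡⟨ sum-cong-≗ {suc n} (λ i → term (toℕ i) (ℕ.≤-pred (toℕ<n i))) ⟩
  ∑[ i < suc n ] (θ f (toℕ i) * g (n ∸ toℕ i) + f (toℕ i) * θ g (n ∸ toℕ i))
    ≡⟨ ∑-distrib-+ {suc n} (λ i → θ f (toℕ i) * g (n ∸ toℕ i)) (λ i → f (toℕ i) * θ g (n ∸ toℕ i)) ⟩
  (θ f ⊛ g ⊕ f ⊛ θ g) n ∎
  where
  open ≡-Reasoning
  term : ∀ i → i ℕ.≤ n → ι n * (f i * g (n ∸ i)) ≡ θ f i * g (n ∸ i) + f i * θ g (n ∸ i)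
  term i i≤n = trans
    (cong (_* (f i * g (n ∸ i))) (trans (cong ι (sym (ℕ.m+[n∸m]≡n i≤n))) (ι-+ i (n ∸ i))))
    (solve 4 (λ a b x y → (a :+ b) :* (x :* y) := a :* x :* y :+ x :* (b :* y)) refl
      (ι i) (ι (n ∸ i)) (f i) (g (n ∸ i)))

*-cancel-ι : ∀ n {x y} → ι (suc n) * x ≡ ι (suc n) * y → x ≡ y
*-cancel-ι n {x} {y} p = trans (sym (recip x)) (trans (cong ((ℤ.+ 1 / suc n) *_) p) (recip y))
  where
  recip : ∀ z → (ℤ.+ 1 / suc n) * (ι (suc n) * z) ≡ z
  recip z = trans (sym (ℚ.*-assoc (ℤ.+ 1 / suc n) (ι (suc n)) z))
    (trans (cong (_* z) (1/n*n (suc n))) (ℚ.*-identityˡ z))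

-- Every positive degree is an invertible rational, so `θ` loses only the constant term.
θ-injective : ∀ {f g} → f 0 ≡ g 0 → θ f ≗ θ g → f ≗ g
θ-injective p q zero    = p
θ-injective p q (suc n) = *-cancel-ι n (q (suc n))

const-⊛ : ∀ c f → const c ⊛ f ≗ c · f
const-⊛ c f zero    = ℚ.+-identityʳ _
const-⊛ c f (suc n) = trans (cong (c * f (suc n) +_) (⊛-zeroˡ f n)) (ℚ.+-identityʳ _)

θ-^ : ∀ g p → θ (g ^ˢ suc p) ≗ const (ι (suc p)) ⊛ (g ^ˢ p ⊛ θ g)
θ-^ g zero = begin
  θ (g ⊛ 1ˢ)          ≈⟨ θ-cong (⊛-identityʳ g) ⟩
  θ g                 ≈⟨ *-identityˡ (θ g) ⟨
  1ˢ ⊛ θ g            ≈⟨ *-identityˡ (1ˢ ⊛ θ g) ⟨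
  1ˢ ⊛ (1ˢ ⊛ θ g)     ∎
  where open ≗-Reasoning
θ-^ g (suc p) = begin
  θ (g ⊛ gᵖ⁺¹)                              ≈⟨ θ-⊛ g gᵖ⁺¹ ⟩
  θ g ⊛ gᵖ⁺¹ ⊕ g ⊛ θ gᵖ⁺¹                   ≈⟨ ⊕-cong {θ g ⊛ gᵖ⁺¹} ≗-refl (⊛-congᶠ {g} ≗-refl (θ-^ g p)) ⟩
  θ g ⊛ (g ⊛ gᵖ) ⊕ g ⊛ (k ⊛ (gᵖ ⊛ θ g))
    ≈⟨ Ser.solve 4 (λ t g q k → t Ser.:* (g Ser.:* q) Ser.:+ g Ser.:* (k Ser.:* (q Ser.:* t))
         Ser.:= (Ser.con 1 Ser.:+ k) Ser.:* ((g Ser.:* q) Ser.:* t)) ≗-refl (θ g) g gᵖ k ⟩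
  -- The solver evaluates its literal `con 1` to `1ˢ ⊕ 0ˢ`.
  (1ˢ ⊕ 0ˢ ⊕ k) ⊛ (gᵖ⁺¹ ⊛ θ g)               ≈⟨ ⊛-congᶠ {g = gᵖ⁺¹ ⊛ θ g} k-suc ≗-refl ⟩
  const (ι (2 ℕ.+ p)) ⊛ (gᵖ⁺¹ ⊛ θ g)        ∎
  where
  open ≗-Reasoning
  gᵖ = g ^ˢ p
  gᵖ⁺¹ = g ^ˢ suc p
  k = const (ι (suc p))
  k-suc : 1ˢ ⊕ 0ˢ ⊕ k ≗ const (ι (2 ℕ.+ p))
  k-suc zero    = sym (ι-+ 1 (suc p))
  k-suc (suc n) = refl

-- Composition and the chain rule

-- The bound `n` is independent of the degree `j`, whereas in `f ⟨ g ⟩` it moves with the degree.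
-- Products are therefore computed on `lincomb` and transferred by `⟨⟩-truncate`.
lincomb : ℕ → (ℕ → ℚ) → (ℕ → Series) → Series
lincomb n c G j = ∑[ i < n ] (c (toℕ i) * G (toℕ i) j)

sum-snoc : ∀ (F : ℕ → ℚ) n → ∑[ i < suc n ] F (toℕ i) ≡ ∑[ i < n ] F (toℕ i) + F n
sum-snoc F zero    = ℚ.+-comm (F 0) 0ℚ
sum-snoc F (suc n) = trans (cong (F 0 +_) (sum-snoc (F ∘ suc) n)) (sym (ℚ.+-assoc (F 0) _ _))

lincomb-⊛ : ∀ n c G h → lincomb n c G ⊛ h ≗ lincomb n c (λ i → G i ⊛ h)
lincomb-⊛ zero    c G h   = ⊛-zeroˡ h
lincomb-⊛ (suc n) c G h j = trans
  (⊛-distribʳ h (c 0 · G 0) (lincomb n (c ∘ suc) (G ∘ suc)) j)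
  (cong₂ _+_ (·-⊛ (c 0) (G 0) h j) (lincomb-⊛ n (c ∘ suc) (G ∘ suc) h j))

θ-lincomb : ∀ n c G → θ (lincomb n c G) ≗ lincomb n c (θ ∘ G)
θ-lincomb n c G j = trans (*-distribˡ-sum {n} (ι j) (λ i → c (toℕ i) * G (toℕ i) j))
  (sum-cong-≗ {n} λ i → solve 3 (λ a b c → a :* (b :* c) := b :* (a :* c)) refl (ι j) (c (toℕ i)) (G (toℕ i) j))

⊛-vanishʳ : ∀ f {h} n → (∀ i → i ℕ.≤ n → h i ≡ 0ℚ) → (f ⊛ h) n ≡ 0ℚ
⊛-vanishʳ f n p = trans (⊛-cong {f} {f} (λ _ _ → refl) p n ℕ.≤-refl) (⊛-zeroʳ f n)

-- Each factor `g` starts in degree 1 or later, so the product of `i` of them starts in degree `i`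
-- or later.
^ˢ-vanish : ∀ g → g 0 ≡ 0ℚ → ∀ i j → j ℕ.< i → (g ^ˢ i) j ≡ 0ℚ
^ˢ-vanish g g₀ (suc i) zero    _         = ⊛-zero g (g ^ˢ i) g₀
^ˢ-vanish g g₀ (suc i) (suc j) (s≤s j<i) = trans
  (cong (_+ ((g ∘ suc) ⊛ g ^ˢ i) j) (trans (cong (_* (g ^ˢ i) (suc j)) g₀) (ℚ.*-zeroˡ ((g ^ˢ i) (suc j)))))
  (trans (ℚ.+-identityˡ (((g ∘ suc) ⊛ g ^ˢ i) j))
    (⊛-vanishʳ (g ∘ suc) j λ k k≤j → ^ˢ-vanish g g₀ i k (ℕ.≤-<-trans k≤j j<i)))

-- Summing beyond the degree adds only powers of `g` that vanish there by `^ˢ-vanish`.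
⟨⟩-truncate : ∀ f g → g 0 ≡ 0ℚ → ∀ n → f ⟨ g ⟩ ≈[ n ] lincomb (suc n) f (g ^ˢ_)
⟨⟩-truncate f g g₀ n i i≤n with ℕ.m≤n⇒m<n∨m≡n i≤n
... | inj₂ refl = refl
⟨⟩-truncate f g g₀ (suc n) i i≤n | inj₁ i<n = begin
  (f ⟨ g ⟩) i
    ≡⟨ ⟨⟩-truncate f g g₀ n i (ℕ.≤-pred i<n) ⟩
  lincomb (suc n) f (g ^ˢ_) i
    ≡⟨ ℚ.+-identityʳ _ ⟨
  lincomb (suc n) f (g ^ˢ_) i + 0ℚ
    ≡⟨ cong (lincomb (suc n) f (g ^ˢ_) i +_)
         (trans (cong (f (suc n) *_) (^ˢ-vanish g g₀ (suc n) i i<n)) (ℚ.*-zeroʳ (f (suc n)))) ⟨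
  lincomb (suc n) f (g ^ˢ_) i + f (suc n) * (g ^ˢ suc n) i
    ≡⟨ sum-snoc (λ k → f k * (g ^ˢ k) i) (suc n) ⟨
  lincomb (2 ℕ.+ n) f (g ^ˢ_) i ∎
  where open ≡-Reasoning

∂ : Series → Series
∂ f n = ι (suc n) * f (suc n)

-- Chain rule, by the power rule in each term. The constant term drops out and shifts the index,
-- leaving `n` terms; the truncation of `∂ f ⟨ g ⟩` has one more, which is zero by `last≡0`.
θ-⟨⟩ : ∀ f g → g 0 ≡ 0ℚ → θ (f ⟨ g ⟩) ≗ (∂ f ⟨ g ⟩) ⊛ θ g
θ-⟨⟩ f g g₀ n = begin
  θ (f ⟨ g ⟩) n
    ≡⟨ θ-lincomb (suc n) f (g ^ˢ_) n ⟩
  f 0 * θ 1ˢ n + lincomb n (f ∘ suc) (λ i → θ (g ^ˢ suc i)) n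
    ≡⟨ cong₂ _+_ (trans (cong (f 0 *_) (θ-1ˢ n)) (ℚ.*-zeroʳ (f 0)))
         (sum-cong-≗ {n} λ i → term (toℕ i)) ⟩
  0ℚ + L
    ≡⟨ ℚ.+-comm 0ℚ L ⟩
  L + 0ℚ
    ≡⟨ cong (L +_) (trans (cong (∂ f n *_) last≡0) (ℚ.*-zeroʳ (∂ f n))) ⟨
  L + ∂ f n * (g ^ˢ n ⊛ θ g) n
    ≡⟨ sum-snoc (λ i → ∂ f i * (g ^ˢ i ⊛ θ g) n) n ⟨
  lincomb (suc n) (∂ f) (λ i → g ^ˢ i ⊛ θ g) n
    ≡⟨ lincomb-⊛ (suc n) (∂ f) (g ^ˢ_) (θ g) n ⟨
  (lincomb (suc n) (∂ f) (g ^ˢ_) ⊛ θ g) n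
    ≡⟨ ⊛-cong {g = θ g} {θ g} (⟨⟩-truncate (∂ f) g g₀ n) (λ _ _ → refl) n ℕ.≤-refl ⟨
  ((∂ f ⟨ g ⟩) ⊛ θ g) n ∎
  where
  open ≡-Reasoning
  L = lincomb n (∂ f) (λ i → g ^ˢ i ⊛ θ g) n

  term : ∀ i → f (suc i) * θ (g ^ˢ suc i) n ≡ ∂ f i * (g ^ˢ i ⊛ θ g) n
  term i = trans
    (cong (f (suc i) *_) (trans (θ-^ g i n) (const-⊛ (ι (suc i)) (g ^ˢ i ⊛ θ g) n)))
    (solve 3 (λ a b c → a :* (b :* c) := b :* a :* c) refl (f (suc i)) (ι (suc i)) ((g ^ˢ i ⊛ θ g) n))

  -- Up to the factor `n + 1` this is a coefficient of `θ (g ^ˢ suc n)`, taken one degree below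
  -- where that power can start.
  last≡0 : (g ^ˢ n ⊛ θ g) n ≡ 0ℚ
  last≡0 = *-cancel-ι n (begin
    ι (suc n) * (g ^ˢ n ⊛ θ g) n              ≡⟨ const-⊛ (ι (suc n)) (g ^ˢ n ⊛ θ g) n ⟨
    (const (ι (suc n)) ⊛ (g ^ˢ n ⊛ θ g)) n    ≡⟨ θ-^ g n n ⟨
    ι n * (g ^ˢ suc n) n                      ≡⟨ cong (ι n *_) (^ˢ-vanish g g₀ (suc n) n ℕ.≤-refl) ⟩
    ι n * 0ℚ                                  ≡⟨ ℚ.*-zeroʳ (ι n) ⟩
    0ℚ                                        ≡⟨ ℚ.*-zeroʳ (ι (suc n)) ⟨
    ι (suc n) * 0ℚ                            ∎)

-- Powers of arcsinh

evens-cong : ∀ {c d : ℕ → ℚ} → c ≗ d → evens c ≗ evens d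
evens-cong p 0             = p 0
evens-cong p 1             = refl
evens-cong p (suc (suc i)) = evens-cong (p ∘ suc) i

-- The weight matters only in even degrees. It is arbitrary so that the induction can pass to
-- `w ∘ suc ∘ suc`.
evens-weight : ∀ c (w : ℕ → ℚ) i → evens c i * w i ≡ evens (λ m → c m * w (2 ℕ.* m)) i
evens-weight c w 0             = refl
evens-weight c w 1             = ℚ.*-zeroˡ (w 1)
evens-weight c w (suc (suc i)) = trans
  (evens-weight (c ∘ suc) (w ∘ suc ∘ suc) i)
  (evens-cong (λ m → cong (λ j → c (suc m) * w j) (sym (ℕ.*-suc 2 m))) i)

-- In odd degrees, `(2m+3)(2m+2)` turns `1/(2m+3)!` into `1/(2m+1)!`.
∂∂sinh : ∂ (∂ sinh) ≗ sinh
∂∂sinh zero    = refl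
∂∂sinh (suc j) = begin
  ι (2 ℕ.+ j) * (ι (3 ℕ.+ j) * evens (c ∘ suc) j)
    ≡⟨ solve 3 (λ a b x → a :* (b :* x) := x :* (b :* a)) refl (ι (2 ℕ.+ j)) (ι (3 ℕ.+ j)) (evens (c ∘ suc) j) ⟩
  evens (c ∘ suc) j * w j
    ≡⟨ evens-weight (c ∘ suc) w j ⟩
  evens (λ m → c (suc m) * w (2 ℕ.* m)) j
    ≡⟨ evens-cong term j ⟩
  evens c j ∎
  where
  open ≡-Reasoning
  c w : ℕ → ℚ
  c m = 1/ suc (2 ℕ.* m) !
  w i = ι (3 ℕ.+ i) * ι (2 ℕ.+ i)

  term : ∀ m → c (suc m) * w (2 ℕ.* m) ≡ c m
  term m = begin
    c (suc m) * (ι (3 ℕ.+ 2 ℕ.* m) * ι (2 ℕ.+ 2 ℕ.* m))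
      ≡⟨ cong (λ j → 1/ suc j ! * (ι (3 ℕ.+ 2 ℕ.* m) * ι (2 ℕ.+ 2 ℕ.* m))) (ℕ.*-suc 2 m) ⟩
    1/ 3 ℕ.+ 2 ℕ.* m ! * (ι (3 ℕ.+ 2 ℕ.* m) * ι (2 ℕ.+ 2 ℕ.* m))
      ≡⟨ ℚ.*-assoc (1/ 3 ℕ.+ 2 ℕ.* m !) _ _ ⟨
    1/ 3 ℕ.+ 2 ℕ.* m ! * ι (3 ℕ.+ 2 ℕ.* m) * ι (2 ℕ.+ 2 ℕ.* m)
      ≡⟨ cong (_* ι (2 ℕ.+ 2 ℕ.* m)) (1/!-suc (2 ℕ.+ 2 ℕ.* m)) ⟩
    1/ 2 ℕ.+ 2 ℕ.* m ! * ι (2 ℕ.+ 2 ℕ.* m)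
      ≡⟨ 1/!-suc (1 ℕ.+ 2 ℕ.* m) ⟩
    c m ∎

⟨⟩-congˡ : ∀ {f f′} g → f ≗ f′ → f ⟨ g ⟩ ≗ f′ ⟨ g ⟩
⟨⟩-congˡ g p n = sum-cong-≗ {suc n} λ i → cong (_* (g ^ˢ toℕ i) n) (p (toℕ i))

⊕-cancelˡ : ∀ f {g h} → f ⊕ g ≗ f ⊕ h → g ≗ h
⊕-cancelˡ f {g} {h} p n = ∙-cancelˡ (f n) (g n) (h n) (p n)

private
  -- `C` is cosh (arcsinh t), with cosh obtained as the derivative of `sinh`.
  T C W : Series
  T = θ arcsinh
  C = ∂ sinh ⟨ arcsinh ⟩
  W = 1ˢ ⊕ X ⊛ X

C⊛T : C ⊛ T ≗ X
C⊛T = begin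
  C ⊛ T                   ≈⟨ θ-⟨⟩ sinh arcsinh refl ⟨
  θ (sinh ⟨ arcsinh ⟩)    ≈⟨ θ-cong sinh-arcsinh ⟩
  θ X                     ≈⟨ θ-X ⟩
  X                       ∎
  where open ≗-Reasoning

θC : θ C ≗ X ⊛ T
θC = begin
  θ C                               ≈⟨ θ-⟨⟩ (∂ sinh) arcsinh refl ⟩
  (∂ (∂ sinh) ⟨ arcsinh ⟩) ⊛ T      ≈⟨ ⊛-congᶠ {g = T} (⟨⟩-congˡ arcsinh ∂∂sinh) ≗-refl ⟩
  (sinh ⟨ arcsinh ⟩) ⊛ T            ≈⟨ ⊛-congᶠ {g = T} sinh-arcsinh ≗-refl ⟩
  X ⊛ T                             ∎
  where open ≗-Reasoning

-- Both sides have the same derivative, which spares the addition theorem cosh² = 1 + sinh².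
C⊛C : C ⊛ C ≗ W
C⊛C = θ-injective refl (begin
  θ (C ⊛ C)                          ≈⟨ θ-⊛ C C ⟩
  θ C ⊛ C ⊕ C ⊛ θ C                  ≈⟨ ⊕-cong (⊛-congᶠ {g = C} θC ≗-refl) (⊛-congᶠ {C} ≗-refl θC) ⟩
  (X ⊛ T) ⊛ C ⊕ C ⊛ (X ⊛ T)          ≈⟨ Ser.solve 3 (λ x t c → (x Ser.:* t) Ser.:* c Ser.:+ c Ser.:* (x Ser.:* t)
                                           Ser.:= (c Ser.:* t) Ser.:* x Ser.:+ x Ser.:* (c Ser.:* t)) ≗-refl X T C ⟩
  (C ⊛ T) ⊛ X ⊕ X ⊛ (C ⊛ T)          ≈⟨ ⊕-cong (⊛-congᶠ {g = X} CT≈θX ≗-refl) (⊛-congᶠ {X} ≗-refl CT≈θX) ⟩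
  θ X ⊛ X ⊕ X ⊛ θ X                  ≈⟨ θ-⊛ X X ⟨
  θ (X ⊛ X)                          ≈⟨ (λ n → ℚ.+-identityˡ (θ (X ⊛ X) n)) ⟨
  0ˢ ⊕ θ (X ⊛ X)                     ≈⟨ ⊕-cong {g = θ (X ⊛ X)} θ-1ˢ ≗-refl ⟨
  θ 1ˢ ⊕ θ (X ⊛ X)                   ≈⟨ θ-⊕ 1ˢ (X ⊛ X) ⟨
  θ W                                ∎)
  where
  open ≗-Reasoning
  CT≈θX : C ⊛ T ≗ θ X
  CT≈θX = ≗-trans C⊛T (≗-sym θ-X)

W⊛T⊛T : W ⊛ (T ⊛ T) ≗ X ⊛ X
W⊛T⊛T = begin
  W ⊛ (T ⊛ T)          ≈⟨ ⊛-congᶠ {g = T ⊛ T} C⊛C ≗-refl ⟨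
  (C ⊛ C) ⊛ (T ⊛ T)    ≈⟨ Ser.solve 2 (λ c t → (c Ser.:* c) Ser.:* (t Ser.:* t) Ser.:= (c Ser.:* t) Ser.:* (c Ser.:* t)) ≗-refl C T ⟩
  (C ⊛ T) ⊛ (C ⊛ T)    ≈⟨ ⊛-congᶠ C⊛T C⊛T ⟩
  X ⊛ X                ∎
  where open ≗-Reasoning

-- Apply `θ` to `C⊛T` and multiply by `C`. With `θC` and `C⊛C` this reads t² T + (1 + t²) θT = (1 +
-- t²) T, and t² T cancels.
W⊛θT : W ⊛ θ T ≗ T
W⊛θT = ⊕-cancelˡ (X ⊛ (T ⊛ X)) (begin
  X ⊛ (T ⊛ X) ⊕ W ⊛ θ T                ≈⟨ ⊕-cong (⊛-congᶠ {X} ≗-refl (⊛-congᶠ {T} ≗-refl C⊛T)) (⊛-congᶠ {g = θ T} C⊛C ≗-refl) ⟨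
  X ⊛ (T ⊛ (C ⊛ T)) ⊕ (C ⊛ C) ⊛ θ T    ≈⟨ Ser.solve 4 (λ x t c u → x Ser.:* (t Ser.:* (c Ser.:* t)) Ser.:+ (c Ser.:* c) Ser.:* u
                                             Ser.:= c Ser.:* ((x Ser.:* t) Ser.:* t Ser.:+ c Ser.:* u)) ≗-refl X T C (θ T) ⟩
  C ⊛ ((X ⊛ T) ⊛ T ⊕ C ⊛ θ T)          ≈⟨ ⊛-congᶠ {C} ≗-refl (⊕-cong {g = C ⊛ θ T} (⊛-congᶠ {g = T} θC ≗-refl) ≗-refl) ⟨
  C ⊛ (θ C ⊛ T ⊕ C ⊛ θ T)              ≈⟨ ⊛-congᶠ {C} ≗-refl (θ-⊛ C T) ⟨
  C ⊛ θ (C ⊛ T)                        ≈⟨ ⊛-congᶠ {C} ≗-refl (≗-trans (θ-cong C⊛T) (≗-trans θ-X (≗-sym C⊛T))) ⟩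
  C ⊛ (C ⊛ T)                          ≈⟨ ⊛-assoc C C T ⟨
  (C ⊛ C) ⊛ T                          ≈⟨ ⊛-congᶠ {g = T} C⊛C ≗-refl ⟩
  W ⊛ T                                ≈⟨ ⊛-distribʳ T 1ˢ (X ⊛ X) ⟩
  1ˢ ⊛ T ⊕ (X ⊛ X) ⊛ T                 ≈⟨ ⊕-cong (*-identityˡ T) (Ser.solve 2 (λ x t → (x Ser.:* x) Ser.:* t Ser.:= x Ser.:* (t Ser.:* x)) ≗-refl X T) ⟩
  T ⊕ X ⊛ (T ⊛ X)                      ≈⟨ (λ n → ℚ.+-comm (T n) _) ⟩
  X ⊛ (T ⊛ X) ⊕ T                      ∎)
  where open ≗-Reasoning

X⊛-suc : ∀ f n → (X ⊛ f) (suc n) ≡ f n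
X⊛-suc f n = trans
  (cong₂ _+_ (ℚ.*-zeroˡ (f (suc n))) (trans (⊛-congᶠ {X ∘ suc} {1ˢ} {f} X∘suc ≗-refl n) (*-identityˡ f n)))
  (ℚ.+-identityˡ (f n))
  where
  X∘suc : X ∘ suc ≗ 1ˢ
  X∘suc zero    = refl
  X∘suc (suc n) = refl

X⊛X⊛-suc-suc : ∀ f n → ((X ⊛ X) ⊛ f) (2 ℕ.+ n) ≡ f n
X⊛X⊛-suc-suc f n = trans (⊛-assoc X X f (2 ℕ.+ n)) (trans (X⊛-suc (X ⊛ f) (suc n)) (X⊛-suc f n))

-- Applying the power rule twice gives one term with `T ⊛ T` and one with `θ T`; the factor `W`
-- turns these into `X ⊛ X` and `T`, and the second term folds back into a first derivative.
W⊛θθ-^ : ∀ p → W ⊛ θ (θ (arcsinh ^ˢ (2 ℕ.+ p))) ≗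
  (X ⊛ X) ⊛ (const (ι (2 ℕ.+ p)) ⊛ (const (ι (suc p)) ⊛ arcsinh ^ˢ p)) ⊕ θ (arcsinh ^ˢ (2 ℕ.+ p))
W⊛θθ-^ p = begin
  W ⊛ θ (θ A₂)
    ≈⟨ ⊛-congᶠ {W} ≗-refl (θ-cong (≗-trans (θ-^ arcsinh (suc p)) (const-⊛ (ι (2 ℕ.+ p)) (A₁ ⊛ T)))) ⟩
  W ⊛ θ (ι (2 ℕ.+ p) · (A₁ ⊛ T))
    ≈⟨ ⊛-congᶠ {W} ≗-refl (≗-trans (λ n → solve 3 (λ a b x → a :* (b :* x) := b :* (a :* x)) refl (ι n) (ι (2 ℕ.+ p)) ((A₁ ⊛ T) n))
         (≗-sym (const-⊛ (ι (2 ℕ.+ p)) (θ (A₁ ⊛ T))))) ⟩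
  W ⊛ (k₂ ⊛ θ (A₁ ⊛ T))
    ≈⟨ ⊛-congᶠ {W} ≗-refl (⊛-congᶠ {k₂} ≗-refl (≗-trans (θ-⊛ A₁ T) (⊕-cong {g = A₁ ⊛ θ T} (⊛-congᶠ {g = T} (θ-^ arcsinh p) ≗-refl) ≗-refl))) ⟩
  W ⊛ (k₂ ⊛ ((k₁ ⊛ (A₀ ⊛ T)) ⊛ T ⊕ A₁ ⊛ θ T))
    ≈⟨ Ser.solve 7 (λ w k₂ k₁ a₀ t a₁ u → w Ser.:* (k₂ Ser.:* ((k₁ Ser.:* (a₀ Ser.:* t)) Ser.:* t Ser.:+ a₁ Ser.:* u))
         Ser.:= (w Ser.:* (t Ser.:* t)) Ser.:* (k₂ Ser.:* (k₁ Ser.:* a₀)) Ser.:+ k₂ Ser.:* (a₁ Ser.:* (w Ser.:* u)))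
         ≗-refl W k₂ k₁ A₀ T A₁ (θ T) ⟩
  (W ⊛ (T ⊛ T)) ⊛ (k₂ ⊛ (k₁ ⊛ A₀)) ⊕ k₂ ⊛ (A₁ ⊛ (W ⊛ θ T))
    ≈⟨ ⊕-cong (⊛-congᶠ {g = k₂ ⊛ (k₁ ⊛ A₀)} W⊛T⊛T ≗-refl)
         (⊛-congᶠ {k₂} ≗-refl (⊛-congᶠ {A₁} ≗-refl W⊛θT)) ⟩
  (X ⊛ X) ⊛ (k₂ ⊛ (k₁ ⊛ A₀)) ⊕ k₂ ⊛ (A₁ ⊛ T)
    ≈⟨ ⊕-cong {(X ⊛ X) ⊛ (k₂ ⊛ (k₁ ⊛ A₀))} ≗-refl (θ-^ arcsinh (suc p)) ⟨
  (X ⊛ X) ⊛ (k₂ ⊛ (k₁ ⊛ A₀)) ⊕ θ A₂ ∎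
  where
  open ≗-Reasoning
  A₀ = arcsinh ^ˢ p
  A₁ = arcsinh ^ˢ suc p
  A₂ = arcsinh ^ˢ (2 ℕ.+ p)
  k₁ = const (ι (suc p))
  k₂ = const (ι (2 ℕ.+ p))

arcsinh-^-rec : ∀ p n → ι (2 ℕ.+ n) * ι (suc n) * (arcsinh ^ˢ (2 ℕ.+ p)) (2 ℕ.+ n) ≡
  ι (2 ℕ.+ p) * ι (suc p) * (arcsinh ^ˢ p) n - ι n * ι n * (arcsinh ^ˢ (2 ℕ.+ p)) n
arcsinh-^-rec p n = begin
  s * t * b
    -- Uses (n+2)(n+1) = (n+2)² - (n+2). The summand `z` is added and subtracted to produce the left
    -- side of `coefficient`.
    ≡⟨ solve 4 (λ s t b z → s :* t :* b :=
         ((s :* ((con 1ℚ :+ t) :* b)) :+ z) :- (z :+ s :* b)) refl s t b (ι n * (ι n * c)) ⟩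
  (s * ((1ℚ + t) * b) + ι n * (ι n * c)) - (ι n * (ι n * c) + s * b)
    ≡⟨ cong (λ x → (s * (x * b) + ι n * (ι n * c)) - (ι n * (ι n * c) + s * b)) (ι-+ 1 (suc n)) ⟨
  (s * (s * b) + ι n * (ι n * c)) - (ι n * (ι n * c) + s * b)
    ≡⟨ cong (_- (ι n * (ι n * c) + s * b)) coefficient ⟩
  (q * (r * a) + s * b) - (ι n * (ι n * c) + s * b)
    ≡⟨ solve 6 (λ q r a y m c → (q :* (r :* a) :+ y) :- (m :* (m :* c) :+ y) := q :* r :* a :- m :* m :* c) refl q r a (s * b) (ι n) c ⟩
  q * r * a - ι n * ι n * c ∎
  where
  open ≡-Reasoning
  s = ι (2 ℕ.+ n)
  t = ι (suc n)
  q = ι (2 ℕ.+ p)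
  r = ι (suc p)
  a = (arcsinh ^ˢ p) n
  b = (arcsinh ^ˢ (2 ℕ.+ p)) (2 ℕ.+ n)
  c = (arcsinh ^ˢ (2 ℕ.+ p)) n
  Θ = θ (θ (arcsinh ^ˢ (2 ℕ.+ p)))
  R = const q ⊛ (const r ⊛ arcsinh ^ˢ p)

  coefficient : s * (s * b) + ι n * (ι n * c) ≡ q * (r * a) + s * b
  coefficient = begin
    Θ (2 ℕ.+ n) + Θ n
      ≡⟨ cong₂ _+_ (*-identityˡ Θ (2 ℕ.+ n)) (X⊛X⊛-suc-suc Θ n) ⟨
    (1ˢ ⊛ Θ) (2 ℕ.+ n) + ((X ⊛ X) ⊛ Θ) (2 ℕ.+ n)
      ≡⟨ ⊛-distribʳ Θ 1ˢ (X ⊛ X) (2 ℕ.+ n) ⟨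
    (W ⊛ Θ) (2 ℕ.+ n)
      ≡⟨ W⊛θθ-^ p (2 ℕ.+ n) ⟩
    ((X ⊛ X) ⊛ R) (2 ℕ.+ n) + s * b
      ≡⟨ cong (_+ s * b) (trans (X⊛X⊛-suc-suc R n)
           (trans (const-⊛ q (const r ⊛ arcsinh ^ˢ p) n) (cong (q *_) (const-⊛ r (arcsinh ^ˢ p) n)))) ⟩
    q * (r * a) + s * b ∎

-- Stirling numbers

σ : ℕ → ℚ
σ i = (- 1ℚ) ^ i

-- f(-x)
alt : Series → Series
alt f i = σ i * f i

alt-⊛ : ∀ f g → alt (f ⊛ g) ≗ alt f ⊛ alt g
alt-⊛ f g n = trans (*-distribˡ-sum {suc n} (σ n) (λ i → f (toℕ i) * g (n ∸ toℕ i)))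
  (sum-cong-≗ {suc n} λ i → term (toℕ i) (ℕ.≤-pred (toℕ<n i)))
  where
  term : ∀ i → i ℕ.≤ n → σ n * (f i * g (n ∸ i)) ≡ alt f i * alt g (n ∸ i)
  term i i≤n = trans
    (cong (_* (f i * g (n ∸ i))) (trans (cong σ (sym (ℕ.m+[n∸m]≡n i≤n))) (^-homo-* (- 1ℚ) i (n ∸ i))))
    (solve 4 (λ a b x y → (a :* b) :* (x :* y) := a :* x :* (b :* y)) refl (σ i) (σ (n ∸ i)) (f i) (g (n ∸ i)))

σ*σ : ∀ i → σ i * σ i ≡ 1ℚ
σ*σ zero    = refl
σ*σ (suc i) = trans (solve 1 (λ x → (con (- 1ℚ) :* x) :* (con (- 1ℚ) :* x) := x :* x) refl (σ i)) (σ*σ i)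

σ-∸ : ∀ {m j} → j ℕ.≤ m → σ (m ∸ j) ≡ σ m * σ j
σ-∸ {m} {j} j≤m = begin
  σ (m ∸ j)                   ≡⟨ ℚ.*-identityʳ _ ⟨
  σ (m ∸ j) * 1ℚ              ≡⟨ cong (σ (m ∸ j) *_) (σ*σ j) ⟨
  σ (m ∸ j) * (σ j * σ j)     ≡⟨ ℚ.*-assoc (σ (m ∸ j)) (σ j) (σ j) ⟨
  σ (m ∸ j) * σ j * σ j       ≡⟨ cong (_* σ j) (^-homo-* (- 1ℚ) (m ∸ j) j) ⟨
  σ (m ∸ j ℕ.+ j) * σ j       ≡⟨ cong (λ x → σ x * σ j) (ℕ.m∸n+n≡m j≤m) ⟩
  σ m * σ j                   ∎
  where open ≡-Reasoning

⊛-linear : ∀ f g → (∀ i → g (2 ℕ.+ i) ≡ 0ℚ) → ∀ n → (f ⊛ g) (suc n) ≡ g 0 * f (suc n) + g 1 * f n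
⊛-linear f g g₂ n = begin
  (f ⊛ g) (suc n)                              ≡⟨ ⊛-comm f g (suc n) ⟩
  g 0 * f (suc n) + ((g ∘ suc) ⊛ f) n          ≡⟨ cong (g 0 * f (suc n) +_) (⊛-congᶠ {g = f} g∘suc ≗-refl n) ⟩
  g 0 * f (suc n) + (const (g 1) ⊛ f) n        ≡⟨ cong (g 0 * f (suc n) +_) (const-⊛ (g 1) f n) ⟩
  g 0 * f (suc n) + g 1 * f n                  ∎
  where
  open ≡-Reasoning
  g∘suc : g ∘ suc ≗ const (g 1)
  g∘suc zero    = refl
  g∘suc (suc i) = g₂ i

-- ∏_{i<n} (i² - x²)
risingSq : ℕ → Series
risingSq n = rising n ⊛ alt (rising n)

-- The new factors `L` and `alt L` are n + x and n - x, with product n² - x².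
risingSq-suc : ∀ n j → risingSq (suc n) (2 ℕ.+ j) ≡ ι n * ι n * risingSq n (2 ℕ.+ j) - risingSq n j
risingSq-suc n j = begin
  ((ρ ⊛ L) ⊛ alt (ρ ⊛ L)) (2 ℕ.+ j)
    ≡⟨ ⊛-congᶠ {ρ ⊛ L} ≗-refl (alt-⊛ ρ L) (2 ℕ.+ j) ⟩
  ((ρ ⊛ L) ⊛ (alt ρ ⊛ alt L)) (2 ℕ.+ j)
    ≡⟨ Ser.solve 4 (λ r l r′ l′ → (r Ser.:* l) Ser.:* (r′ Ser.:* l′) Ser.:= ((r Ser.:* r′) Ser.:* l) Ser.:* l′)
         ≗-refl ρ L (alt ρ) (alt L) (2 ℕ.+ j) ⟩
  ((P ⊛ L) ⊛ alt L) (2 ℕ.+ j)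
    ≡⟨ ⊛-linear (P ⊛ L) (alt L) (λ i → ℚ.*-zeroʳ (σ (2 ℕ.+ i))) (suc j) ⟩
  1ℚ * (0ℚ + ι n) * (P ⊛ L) (2 ℕ.+ j) + - 1ℚ * (P ⊛ L) (suc j)
    ≡⟨ cong₂ (λ x y → 1ℚ * (0ℚ + ι n) * x + - 1ℚ * y)
         (⊛-linear P L (λ _ → refl) (suc j)) (⊛-linear P L (λ _ → refl) j) ⟩
  1ℚ * (0ℚ + ι n) * ((0ℚ + ι n) * P (2 ℕ.+ j) + 1ℚ * P (suc j)) + - 1ℚ * ((0ℚ + ι n) * P (suc j) + 1ℚ * P j)
    ≡⟨ solve 4 (λ a x y z →
         con 1ℚ :* (con 0ℚ :+ a) :* ((con 0ℚ :+ a) :* x :+ con 1ℚ :* y) :+ con (- 1ℚ) :* ((con 0ℚ :+ a) :* y :+ con 1ℚ :* z)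
         := a :* a :* x :- z) refl (ι n) (P (2 ℕ.+ j)) (P (suc j)) (P j) ⟩
  ι n * ι n * P (2 ℕ.+ j) - P j ∎
  where
  open ≡-Reasoning
  ρ = rising n
  L = X ⊕ const (ι n)
  P = risingSq n

rising-zero : ∀ n → rising (suc n) 0 ≡ 0ℚ
rising-zero zero    = refl
rising-zero (suc n) = ⊛-zero (rising (suc n)) (X ⊕ const (ι (suc n))) (rising-zero n)

-- Pairs the indices m - j and m + j around the middle. The induction removes the outermost pair, 0
-- and 2m, and shifts both series by one.
⊛-fold : ∀ f g m → (f ⊛ g) (2 ℕ.* m) ≡
  f m * g m + ∑[ i < m ] (f (m ∸ suc (toℕ i)) * g (m ℕ.+ suc (toℕ i)) + f (m ℕ.+ suc (toℕ i)) * g (m ∸ suc (toℕ i)))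
⊛-fold f g zero    = refl
⊛-fold f g (suc m) = begin
  (f ⊛ g) (2 ℕ.* suc m)
    ≡⟨ cong (f ⊛ g) (ℕ.*-suc 2 m) ⟩
  f 0 * g M + ((f ∘ suc) ⊛ g) (suc (2 ℕ.* m))
    ≡⟨ cong (f 0 * g M +_) (⊛-sucʳ (f ∘ suc) g (2 ℕ.* m)) ⟩
  f 0 * g M + (f M * g 0 + ((f ∘ suc) ⊛ (g ∘ suc)) (2 ℕ.* m))
    ≡⟨ cong (λ x → f 0 * g M + (f M * g 0 + x)) (⊛-fold (f ∘ suc) (g ∘ suc) m) ⟩
  f 0 * g M + (f M * g 0 + (f (suc m) * g (suc m) + ∑[ i < m ] H′ (toℕ i)))
    ≡⟨ cong (λ x → f 0 * g M + (f M * g 0 + (f (suc m) * g (suc m) + x)))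
         -- `suc` moves inside the truncated subtraction because `i` is below `m`.
         (sum-cong-≗ {m} λ i → cong
           (λ x → f x * g (suc m ℕ.+ suc (toℕ i)) + f (suc m ℕ.+ suc (toℕ i)) * g x)
           (sym (ℕ.+-∸-assoc 1 (toℕ<n i)))) ⟩
  f 0 * g M + (f M * g 0 + (f (suc m) * g (suc m) + ∑[ i < m ] H (toℕ i)))
    ≡⟨ solve 4 (λ a b c d → a :+ (b :+ (c :+ d)) := c :+ (d :+ (a :+ b))) refl
         (f 0 * g M) (f M * g 0) (f (suc m) * g (suc m)) (∑[ i < m ] H (toℕ i)) ⟩
  f (suc m) * g (suc m) + (∑[ i < m ] H (toℕ i) + (f 0 * g M + f M * g 0))
    ≡⟨ cong (λ x → f (suc m) * g (suc m) + (∑[ i < m ] H (toℕ i) + x))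
         (cong₂ (λ x y → f x * g y + f y * g x) (sym (ℕ.n∸n≡0 m)) M≡) ⟩
  f (suc m) * g (suc m) + (∑[ i < m ] H (toℕ i) + H m)
    ≡⟨ cong (f (suc m) * g (suc m) +_) (sum-snoc H m) ⟨
  f (suc m) * g (suc m) + ∑[ i < suc m ] H (toℕ i) ∎
  where
  open ≡-Reasoning
  M = 2 ℕ.+ 2 ℕ.* m
  H H′ : ℕ → ℚ
  H  i = f (suc m ∸ suc i) * g (suc m ℕ.+ suc i) + f (suc m ℕ.+ suc i) * g (suc m ∸ suc i)
  H′ i = f (suc (m ∸ suc i)) * g (suc (m ℕ.+ suc i)) + f (suc (m ℕ.+ suc i)) * g (suc (m ∸ suc i))

  M≡ : M ≡ suc m ℕ.+ suc m
  M≡ = trans (sym (ℕ.*-suc 2 m)) (cong (suc m ℕ.+_) (ℕ.+-identityʳ (suc m)))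

-- The signs at M - j and M + j agree, so the members of each pair in `⊛-fold` coincide and give the
-- factor 2. The pair j = M contains the constant term of `rising (suc n)`, which is zero, so the
-- sum stops at M - 1 as in `⟦_,_⟧`.
risingSq-even : ∀ n m → risingSq (suc n) (2 ℕ.* suc m) ≡ σ (suc m) * ⟦ suc n , suc m ⟧
risingSq-even n m = begin
  (f ⊛ alt f) (2 ℕ.* M)
    ≡⟨ ⊛-fold f (alt f) M ⟩
  f M * alt f M + ∑[ i < M ] (f (M ∸ suc (toℕ i)) * alt f (M ℕ.+ suc (toℕ i)) + f (M ℕ.+ suc (toℕ i)) * alt f (M ∸ suc (toℕ i)))
    ≡⟨ cong (f M * alt f M +_) (sum-cong-≗ {M} λ i → term (suc (toℕ i)) (toℕ<n i)) ⟩
  f M * alt f M + ∑[ i < M ] (σ M * two * K (toℕ i))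
    ≡⟨ cong (f M * alt f M +_) (*-distribˡ-sum {M} (σ M * two) (λ i → K (toℕ i))) ⟨
  f M * alt f M + σ M * two * ∑[ i < M ] K (toℕ i)
    ≡⟨ cong (λ x → f M * alt f M + σ M * two * x)
         (trans (sum-snoc K m) (trans (cong (∑[ i < m ] K (toℕ i) +_) last≡0) (ℚ.+-identityʳ _))) ⟩
  f M * (σ M * f M) + σ M * two * ∑[ i < m ] K (toℕ i)
    ≡⟨ solve 4 (λ a s t z → a :* (s :* a) :+ s :* t :* z := s :* (a :* (a :* con 1ℚ) :+ t :* z)) refl
         (f M) (σ M) two (∑[ i < m ] K (toℕ i)) ⟩
  σ M * ⟦ suc n , M ⟧ ∎
  where
  open ≡-Reasoning
  f = rising (suc n)
  M = suc m
  two = ℤ.+ 2 / 1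
  K : ℕ → ℚ
  K i = σ (suc i) * f (M ∸ suc i) * f (M ℕ.+ suc i)

  last≡0 : K m ≡ 0ℚ
  last≡0 rewrite ℕ.n∸n≡0 m | rising-zero n =
    trans (cong (_* f (M ℕ.+ M)) (ℚ.*-zeroʳ (σ M))) (ℚ.*-zeroˡ (f (M ℕ.+ M)))

  term : ∀ j → j ℕ.≤ M → f (M ∸ j) * alt f (M ℕ.+ j) + f (M ℕ.+ j) * alt f (M ∸ j) ≡
    σ M * two * (σ j * f (M ∸ j) * f (M ℕ.+ j))
  term j j≤M = trans
    (cong₂ (λ x y → f (M ∸ j) * (x * f (M ℕ.+ j)) + f (M ℕ.+ j) * (y * f (M ∸ j))) (^-homo-* (- 1ℚ) M j) (σ-∸ j≤M))
    (solve 4 (λ a b s t → a :* (s :* t :* b) :+ b :* (s :* t :* a) := s :* con two :* (t :* a :* b)) refl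
      (f (M ∸ j)) (f (M ℕ.+ j)) (σ M) (σ j))

-- Matching the two recurrences

-4ℚ ¼ : ℚ
-4ℚ = -[1+ 3 ] / 1
¼   = ℤ.+ 1 / 4

-- To be used at N = 2n and M = 2m; kept separate because 2 * suc n does not reduce to 2 + 2 * n.
EvenCoefficient : (n m N M : ℕ) → Set
EvenCoefficient n m N M = ι (N !) * (arcsinh ^ˢ M) N ≡ ι (M !) * (-4ℚ ^ n * ¼ ^ m * risingSq n M)

ι-!-suc-suc : ∀ i → ι ((2 ℕ.+ i) !) ≡ ι (2 ℕ.+ i) * ι (suc i) * ι (i !)
ι-!-suc-suc i = trans (ι-* (2 ℕ.+ i) (suc i !))
  (trans (cong (ι (2 ℕ.+ i) *_) (ι-* (suc i) (i !))) (sym (ℚ.*-assoc (ι (2 ℕ.+ i)) (ι (suc i)) (ι (i !)))))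

-- In degree 2n the recurrence for powers of `arcsinh` has the factor (2n)² = 4n² where
-- `risingSq-suc` has n², and the opposite sign. The extra `¼` absorbs the 4, and -4 times `¼`
-- supplies the sign.
evenCoefficient-suc : ∀ n m M → EvenCoefficient n m (2 ℕ.* n) M →
  EvenCoefficient n (suc m) (2 ℕ.* n) (2 ℕ.+ M) → EvenCoefficient (suc n) (suc m) (2 ℕ.+ 2 ℕ.* n) (2 ℕ.+ M)
evenCoefficient-suc n m M Fa Fc = begin
  ι ((2 ℕ.+ N) !) * b
    ≡⟨ cong (_* b) (ι-!-suc-suc N) ⟩
  s * t * F * b
    ≡⟨ solve 4 (λ s t f b → s :* t :* f :* b := f :* (s :* t :* b)) refl s t F b ⟩
  F * (s * t * b)
    ≡⟨ cong (F *_) (arcsinh-^-rec M N) ⟩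
  F * (q * r * a - ι N * ι N * c)
    ≡⟨ cong (λ x → F * (q * r * a - x * x * c)) (ι-* 2 n) ⟩
  F * (q * r * a - ι 2 * ι n * (ι 2 * ι n) * c)
    ≡⟨ solve 6 (λ f q r a i c → f :* (q :* r :* a :- con (ι 2) :* i :* (con (ι 2) :* i) :* c)
         := q :* r :* (f :* a) :- con (ι 4) :* i :* i :* (f :* c)) refl F q r a (ι n) c ⟩
  q * r * (F * a) - ι 4 * ι n * ι n * (F * c)
    ≡⟨ cong₂ (λ x y → q * r * x - ι 4 * ι n * ι n * y) Fa (trans Fc (cong (_* (e * (¼ * h) * p₂)) (ι-!-suc-suc M))) ⟩
  q * r * (G * (e * h * p₀)) - ι 4 * ι n * ι n * (q * r * G * (e * (¼ * h) * p₂))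
    ≡⟨ solve 8 (λ q r g e h p₀ i p₂ →
         q :* r :* (g :* (e :* h :* p₀)) :- con (ι 4) :* i :* i :* (q :* r :* g :* (e :* (con ¼ :* h) :* p₂))
         := q :* r :* g :* (con -4ℚ :* e :* (con ¼ :* h) :* (i :* i :* p₂ :- p₀))) refl q r G e h p₀ (ι n) p₂ ⟩
  q * r * G * (-4ℚ * e * (¼ * h) * (ι n * ι n * p₂ - p₀))
    ≡⟨ cong₂ (λ x y → x * (-4ℚ * e * (¼ * h) * y)) (ι-!-suc-suc M) (risingSq-suc n M) ⟨
  ι ((2 ℕ.+ M) !) * (-4ℚ * e * (¼ * h) * risingSq (suc n) (2 ℕ.+ M)) ∎
  where
  open ≡-Reasoning
  N = 2 ℕ.* n
  F = ι (N !)
  G = ι (M !)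
  s = ι (2 ℕ.+ N)
  t = ι (suc N)
  q = ι (2 ℕ.+ M)
  r = ι (suc M)
  a = (arcsinh ^ˢ M) N
  b = (arcsinh ^ˢ (2 ℕ.+ M)) (2 ℕ.+ N)
  c = (arcsinh ^ˢ (2 ℕ.+ M)) N
  e = -4ℚ ^ n
  h = ¼ ^ m
  p₀ = risingSq n M
  p₂ = risingSq n (2 ℕ.+ M)

-- Induction on `n` for all `m`, since row n + 1 uses columns m and m + 1 of row n. Both sides
-- vanish on the borders: for n = 0 < m by order of vanishing, for m = 0 < n because `rising` has no
-- constant term.
arcsinh-^-even : ∀ n m → EvenCoefficient n m (2 ℕ.* n) (2 ℕ.* m)
arcsinh-^-even zero zero = refl
arcsinh-^-even zero (suc m) = trans
  (cong (1ℚ *_) (^ˢ-vanish arcsinh refl (2 ℕ.* suc m) 0 (s≤s z≤n)))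
  (sym (trans (cong (λ x → G * (1ℚ * ¼ ^ suc m * x))
      (trans (*-identityˡ (alt 1ˢ) (2 ℕ.* suc m)) (ℚ.*-zeroʳ (σ (2 ℕ.* suc m)))))
    (solve 2 (λ g h → g :* (con 1ℚ :* h :* con 0ℚ) := con 0ℚ) refl G (¼ ^ suc m))))
  where G = ι ((2 ℕ.* suc m) !)
arcsinh-^-even (suc n) zero = trans (ℚ.*-zeroʳ (ι ((2 ℕ.* suc n) !)))
  (sym (trans (cong (λ x → 1ℚ * (-4ℚ ^ suc n * 1ℚ * x)) (⊛-zero (rising (suc n)) (alt (rising (suc n))) (rising-zero n)))
    (solve 1 (λ g → con 1ℚ :* (g :* con 1ℚ :* con 0ℚ) := con 0ℚ) refl (-4ℚ ^ suc n))))
arcsinh-^-even (suc n) (suc m) = subst₂ (EvenCoefficient (suc n) (suc m)) (sym (ℕ.*-suc 2 n)) (sym (ℕ.*-suc 2 m))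
  (evenCoefficient-suc n m (2 ℕ.* m) (arcsinh-^-even n m)
    (subst (EvenCoefficient n (suc m) (2 ℕ.* n)) (ℕ.*-suc 2 m) (arcsinh-^-even n (suc m))))

-- `¼ ^ m * σ m` is the inverse of `-4ℚ ^ m`; `m ≤ n` makes `n ∸ m` a true difference.
-4^*¼^*σ : ∀ {m n} → m ℕ.≤ n → -4ℚ ^ n * ¼ ^ m * σ m ≡ -4ℚ ^ (n ∸ m)
-4^*¼^*σ {m} {n} m≤n = begin
  -4ℚ ^ n * ¼ ^ m * σ m                        ≡⟨ cong (λ x → -4ℚ ^ x * ¼ ^ m * σ m) (ℕ.m∸n+n≡m m≤n) ⟨
  -4ℚ ^ (n ∸ m ℕ.+ m) * ¼ ^ m * σ m            ≡⟨ cong (λ x → x * ¼ ^ m * σ m) (^-homo-* -4ℚ (n ∸ m) m) ⟩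
  -4ℚ ^ (n ∸ m) * -4ℚ ^ m * ¼ ^ m * σ m        ≡⟨ solve 4 (λ a b c d → a :* b :* c :* d := a :* (b :* c :* d)) refl (-4ℚ ^ (n ∸ m)) (-4ℚ ^ m) (¼ ^ m) (σ m) ⟩
  -4ℚ ^ (n ∸ m) * (-4ℚ ^ m * ¼ ^ m * σ m)      ≡⟨ cong (-4ℚ ^ (n ∸ m) *_) (unit m) ⟩
  -4ℚ ^ (n ∸ m) * 1ℚ                           ≡⟨ ℚ.*-identityʳ _ ⟩
  -4ℚ ^ (n ∸ m)                                ∎
  where
  open ≡-Reasoning
  unit : ∀ m → -4ℚ ^ m * ¼ ^ m * σ m ≡ 1ℚ
  unit zero    = refl
  unit (suc m) = trans
    (solve 3 (λ a b c → con -4ℚ :* a :* (con ¼ :* b) :* (con (- 1ℚ) :* c) := a :* b :* c) refl (-4ℚ ^ m) (¼ ^ m) (σ m))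
    (unit m)

-- Assembling the closed form

sum-evens : ∀ c (h : ℕ → ℚ) n →
  ∑[ i < suc (2 ℕ.* n) ] (evens c (toℕ i) * h (toℕ i)) ≡ ∑[ m < suc n ] (c (toℕ m) * h (2 ℕ.* toℕ m))
sum-evens c h zero    = refl
sum-evens c h (suc n) = begin
  ∑[ i < suc (2 ℕ.* suc n) ] (evens c (toℕ i) * h (toℕ i))
    ≡⟨ cong (λ x → ∑[ i < suc x ] (evens c (toℕ i) * h (toℕ i))) (ℕ.*-suc 2 n) ⟩
  c 0 * h 0 + (0ℚ * h 1 + S)
    ≡⟨ solve 3 (λ a b s → a :+ (con 0ℚ :* b :+ s) := a :+ s) refl (c 0 * h 0) (h 1) S ⟩
  c 0 * h 0 + S
    ≡⟨ cong (c 0 * h 0 +_) (trans (sum-evens (c ∘ suc) (h ∘ suc ∘ suc) n)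
         (sum-cong-≗ {suc n} λ i → cong (λ x → c (suc (toℕ i)) * h x) (sym (ℕ.*-suc 2 (toℕ i))))) ⟩
  c 0 * h 0 + ∑[ m < suc n ] (c (suc (toℕ m)) * h (2 ℕ.* suc (toℕ m))) ∎
  where
  open ≡-Reasoning
  S = ∑[ i < suc (2 ℕ.* n) ] (evens (c ∘ suc) (toℕ i) * h (2 ℕ.+ toℕ i))

theorem1 : (n : ℕ) (k : ℤ) → 1 ℕ.≤ n →
    𝔠 k (2 ℕ.* n) ≡ ∑[ i < n ] (let m = suc (toℕ i) in (-[1+ 3 ] / 1) ^ (n ∸ m) * suc (2 ℕ.* m) ^ℤ (ℤ.- k) * ⟦ n , m ⟧)
theorem1 n@(suc n-1) k _ = begin
  F * (Lif₂ k ⟨ arcsinh ⟩) (2 ℕ.* n)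
    ≡⟨ cong (F *_) (sum-evens c (λ i → (arcsinh ^ˢ i) (2 ℕ.* n)) n) ⟩
  -- The zero is the coefficient of `arcsinh ^ˢ 0`, the constant series 1, in degree 2n; matching
  -- `n` as a successor makes this degree positive.
  F * (c 0 * 0ℚ + S)
    ≡⟨ cong (F *_) (trans (cong (_+ S) (ℚ.*-zeroʳ (c 0))) (ℚ.+-identityˡ S)) ⟩
  F * S
    ≡⟨ *-distribˡ-sum {n} F (λ i → c (suc (toℕ i)) * β (suc (toℕ i))) ⟩
  ∑[ i < n ] (F * (c (suc (toℕ i)) * β (suc (toℕ i))))
    ≡⟨ sum-cong-≗ {n} (λ i → term (toℕ i) (toℕ<n i)) ⟩
  ∑[ i < n ] (-4ℚ ^ (n ∸ suc (toℕ i)) * suc (2 ℕ.* suc (toℕ i)) ^ℤ (ℤ.- k) * ⟦ n , suc (toℕ i) ⟧) ∎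
  where
  open ≡-Reasoning
  F = ι ((2 ℕ.* n) !)
  c β : ℕ → ℚ
  c m = 1/ (2 ℕ.* m) ! * suc (2 ℕ.* m) ^ℤ (ℤ.- k)
  β m = (arcsinh ^ˢ (2 ℕ.* m)) (2 ℕ.* n)
  S = ∑[ i < n ] (c (suc (toℕ i)) * β (suc (toℕ i)))

  term : ∀ i → i ℕ.< n → F * (c (suc i) * β (suc i)) ≡
    -4ℚ ^ (n ∸ suc i) * suc (2 ℕ.* suc i) ^ℤ (ℤ.- k) * ⟦ n , suc i ⟧
  term i i<n = begin
    F * (u * y * β m)
      ≡⟨ solve 4 (λ f u y b → f :* (u :* y :* b) := u :* y :* (f :* b)) refl F u y (β m) ⟩
    u * y * (F * β m)
      ≡⟨ cong (u * y *_) (arcsinh-^-even n m) ⟩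
    u * y * (G * (-4ℚ ^ n * ¼ ^ m * risingSq n (2 ℕ.* m)))
      ≡⟨ cong (λ x → u * y * (G * (-4ℚ ^ n * ¼ ^ m * x))) (risingSq-even n-1 i) ⟩
    u * y * (G * (-4ℚ ^ n * ¼ ^ m * (σ m * ⟦ n , m ⟧)))
      ≡⟨ solve 7 (λ u y g e h s w → u :* y :* (g :* (e :* h :* (s :* w))) := u :* g :* (e :* h :* s :* y :* w)) refl
           u y G (-4ℚ ^ n) (¼ ^ m) (σ m) ⟦ n , m ⟧ ⟩
    u * G * (-4ℚ ^ n * ¼ ^ m * σ m * y * ⟦ n , m ⟧)
      -- The `1/(2m)!` of `Lif₂` cancels the (2m)! of `arcsinh-^-even`, while the sign from
      -- `risingSq-even` joins the powers of -4 and `¼`.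
      ≡⟨ cong₂ (λ x z → x * (z * y * ⟦ n , m ⟧)) (1/!*! (2 ℕ.* m)) (-4^*¼^*σ i<n) ⟩
    1ℚ * (-4ℚ ^ (n ∸ m) * y * ⟦ n , m ⟧)
      ≡⟨ ℚ.*-identityˡ _ ⟩
    -4ℚ ^ (n ∸ m) * y * ⟦ n , m ⟧ ∎
    where
    m = suc i
    u = 1/ (2 ℕ.* m) !
    G = ι ((2 ℕ.* m) !)
    y = suc (2 ℕ.* m) ^ℤ (ℤ.- k)
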